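{- Let $n$ be a positive integer with $n\equiv 3\pmod 4$. Then the wheel graph $W_n$ satisfies $ced(W_n)=cvd(W_n)=1$.
   Context: Graphs are finite and may have multiple edges but not loops. A binary labeling of a graph $G$ is a function $f:V(G)\to\{0,1\}$. Two real numbers $x,y$ are roughly equal if $0\le |x-y|\le 1$. A binary labeling $f$ is friendly if $|f^{ -1}(0)|$ and $|f^{ -1}(1)|$ are roughly equal. A binary labeling $f$ induces an edge labeling $f_e:E(G)\to\{0,1\}$ by $f_e(uv)=f(u)+f(v)$ modulo 2. A friendly labeling $f$ of $G$ is cordial if $|f_e^{ -1}(0)|$ and $|f_e^{ -1}(1)|$ are roughly equal. The cordial edge deficiency $ced(G)$ is the minimum, over all friendly labelings $f$ of $G$, of the number of edges that must be added to $G$ between pairs of distinct vertices of $G$ (multiple edges allowed) so that $f$ becomes a cordial labeling of the augmented graph $G'$. The cordial vertex deficiency $cvd(G)$ is the minimum, over all binary labelings $f$ of $G$ (not necessarily friendly) for which $|f_e^{ -1}(0)|$ and $|f_e^{ -1}(1)|$ are roughly equal, of the number of labeled vertices (added as isolated vertices, with labels in $\{0,1\}$ chosen appropriately) that must be added to $G$ so that the resulting labeling of the augmented graph $G'$ is cordial; if no such binary labeling exists, $cvd(G)=\infty$. The wheel graph $W_n$ is obtained from the cycle $C_n$ by adding one further vertex (the central vertex) and joining it to each of the $n$ vertices of the cycle, so $W_n$ has $n+1$ vertices and $2n$ edges. -}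

module Defs where

open import Data.Fin.Base using (Fin; zero; suc; toℕ; fromℕ; inject₁; _↑ˡ_)
open import Data.Fin.Properties using (_≟_; suc-injective; ↑ˡ-injective; toℕ-inject₁)
open import Data.List.Base using (List; _∷_; _++_; map; filter; length; tabulate; allFin)
open import Data.Nat.Base using (ℕ; suc; _+_; _≤_; s≤s; ∣_-_∣)
open import Data.Nat.DivMod using (_%_; _mod_; m%n≤m)
open import Data.Nat.Properties using (1+n≢n)
open import Data.Product.Base using (∃-syntax; _×_)
import Data.Vec.Functional as Vector
open import Function.Definitions using (Injective)
open import Relation.Binary.PropositionalEquality
  using (_≡_; _≢_; refl; sym; trans; cong; subst)
open import Relation.Nullary.Construct.Add.Supremum using (_⁺; ⊤⁺; [_])
open import Relation.Nullary.Negation.Core using (¬_)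

-- Edges are unordered, but their endpoints are stored in some order; nothing
-- below depends on that order.
record Edge (n : ℕ) : Set where
  constructor edge
  field
    end₁ end₂ : Fin n
    .loopless : end₁ ≢ end₂

open Edge public

-- Repetitions in the list are multiple edges.
record Graph (n : ℕ) : Set where
  constructor graph
  field
    edges : List (Edge n)

open Graph public

mapEdge : ∀ {m n} (φ : Fin m → Fin n) → Injective _≡_ _≡_ φ → Edge m → Edge n
mapEdge φ φ-inj (edge u v u≢v) = edge (φ u) (φ v) (λ eq → u≢v (φ-inj eq))

addEdges : ∀ {n} → Graph n → List (Edge n) → Graph n
addEdges G es = graph (edges G ++ es)

addIsolated : ∀ {n} → Graph n → (k : ℕ) → Graph (n + k)
addIsolated G k = graph (map (mapEdge (_↑ˡ k) (λ {u} {v} → ↑ˡ-injective k u v)) (edges G))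

Labeling : ℕ → Set
Labeling n = Fin n → Fin 2

edgeLabel : ∀ {n} → Labeling n → Edge n → Fin 2
edgeLabel f e = (toℕ (f (end₁ e)) + toℕ (f (end₂ e))) mod 2

#vertices : ∀ {n} → Labeling n → Fin 2 → ℕ
#vertices {n} f b = length (filter (λ v → f v ≟ b) (allFin n))

#edges : ∀ {n} → Graph n → Labeling n → Fin 2 → ℕ
#edges G f b = length (filter (λ e → edgeLabel f e ≟ b) (edges G))

RoughlyEqual : ℕ → ℕ → Set
RoughlyEqual x y = ∣ x - y ∣ ≤ 1

Friendly : ∀ {n} → Labeling n → Set
Friendly f = RoughlyEqual (#vertices f zero) (#vertices f (suc zero))

EdgeBalanced : ∀ {n} → Graph n → Labeling n → Set
EdgeBalanced G f = RoughlyEqual (#edges G f zero) (#edges G f (suc zero))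

Cordial : ∀ {n} → Graph n → Labeling n → Set
Cordial G f = Friendly f × EdgeBalanced G f

IsMinimum : (ℕ → Set) → ℕ → Set
IsMinimum P k = P k × (∀ j → P j → k ≤ j)

EdgesNeeded : ∀ {n} → Graph n → Labeling n → ℕ → Set
EdgesNeeded {n} G f =
  IsMinimum (λ k → ∃[ es ] length {A = Edge n} es ≡ k × Cordial (addEdges G es) f)

-- "k is the cordial edge deficiency of G".  A relation rather than a function
-- because no number of added edges may suffice, e.g. for two vertices joined
-- by two parallel edges.
IsCed : ∀ {n} → Graph n → ℕ → Set
IsCed {n} G = IsMinimum (λ k → ∃[ f ] Friendly {n} f × EdgesNeeded G f k)

VerticesNeeded : ∀ {n} → Graph n → Labeling n → ℕ → Set
VerticesNeeded G f =
  IsMinimum (λ k → ∃[ g ] Cordial (addIsolated G k) (Vector._++_ {n = k} f g))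

-- "x is the cordial vertex deficiency of G", with ⊤⁺ as ∞.
IsCvd : ∀ {n} → Graph n → ℕ ⁺ → Set
IsCvd {n} G [ k ] = IsMinimum (λ j → ∃[ f ] EdgeBalanced {n} G f × VerticesNeeded G f j) k
IsCvd {n} G ⊤⁺    = ∀ f → ¬ EdgeBalanced {n} G f

cycle : (n : ℕ) → 3 ≤ n → Graph n
cycle (suc (suc m)) (s≤s (s≤s _)) =
  graph (edge (fromℕ (suc m)) zero (λ ())
        ∷ tabulate (λ i → edge (inject₁ i) (suc i) (inject₁≢suc i)))
  where
  inject₁≢suc : (i : Fin (suc m)) → inject₁ i ≢ suc i
  inject₁≢suc i eq = 1+n≢n (trans (sym (cong toℕ eq)) (toℕ-inject₁ i))

-- The apex is zero; the vertex i of G becomes suc i.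
cone : ∀ {n} → Graph n → Graph (suc n)
cone G = graph (tabulate (λ i → edge zero (suc i) (λ ()))
               ++ map (mapEdge suc suc-injective) (edges G))

wheel : (n : ℕ) → 3 ≤ n → Graph (suc n)
wheel n 3≤n = cone (cycle n 3≤n)

n%4≡3⇒3≤n : ∀ n → n % 4 ≡ 3 → 3 ≤ n
n%4≡3⇒3≤n n n%4≡3 = subst (_≤ n) n%4≡3 (m%n≤m n 4)

{-# OPTIONS --safe #-}
-- Lower bounds: in W_n with n odd every vertex has odd degree, so the number of
-- edges labelled 1 has the parity of the number of vertices labelled 1.  For
-- n = 4q + 3 a cordial labeling would have 2q + 2 vertices and 4q + 3 edges
-- labelled 1, a contradiction.
--
-- Upper bounds: label the rim 0011 0011 … 001.  Labelling the centre 1 makes the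
-- labeling friendly with 4q + 4 edges labelled 1 and 4q + 2 labelled 0, which one
-- extra 0-edge repairs.  Labelling the centre 0 balances the edges with 2q + 3
-- vertices labelled 0 and 2q + 1 labelled 1, which one extra 1-vertex repairs.
module Submission where

open import Defs
open import Data.Bool.Base using (true; false)
open import Data.Fin.Base using (Fin; zero; suc; toℕ; fromℕ; inject₁; splitAt)
open import Data.Fin.Patterns using (0F; 1F)
open import Data.Fin.Properties using (_≟_; <⇒≢; ≤̄⇒inject₁<; ≤-refl)
open import Data.List.Base using (List; []; _∷_; _++_; map; filter; length; tabulate; allFin)
open import Data.List.Properties
  using (map-++; map-∘; map-cong; map-tabulate; tabulate-cong; length-map;
         length-tabulate; filter-++; length-++; ++-identityʳ)
open import Data.Nat.Base using (ℕ; NonZero; zero; suc; _+_; _*_; _≤_; z≤n; s≤s)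
open import Data.Nat.DivMod using (_/_; _%_; _mod_; m≡m%n+[m/n]*n)
open import Data.Nat.ListAction using (sum)
open import Data.Nat.ListAction.Properties using (sum-++)
open import Data.Nat.Properties
  using (∣n-n∣≡0; even≢odd; suc-injective; +-identityʳ; +-suc)
open import Data.Nat.Tactic.RingSolver using (solve-∀)
open import Data.Product.Base using (_×_; _,_; ∃-syntax)
open import Data.Sum.Properties using ([,]-map)
open import Data.Unit.Base using (tt)
import Data.Vec.Functional as Vector
open import Data.Vec.Functional.Properties using (lookup-++ˡ)
open import Function.Base using (_∘_; id)
open import Relation.Binary.PropositionalEquality
  using (_≡_; refl; sym; trans; cong; cong₂; subst; subst₂; module ≡-Reasoning)
open import Relation.Nullary.Construct.Add.Supremum using ([_])
open import Relation.Nullary.Decidable.Core using (does)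
open import Relation.Nullary.Negation.Core using (¬_; contradiction)

open ≡-Reasoning

-- Counting labels in lists.

count : Fin 2 → List (Fin 2) → ℕ
count b = length ∘ filter (_≟ b)

-- Moves the labeling out of the filter predicate, so that `#vertices` and `#edges` become counts in
-- plain lists of labels.
count-map : ∀ {A : Set} (g : A → Fin 2) b xs →
  length (filter (λ x → g x ≟ b) xs) ≡ count b (map g xs)
count-map g b []       = refl
count-map g b (x ∷ xs) with does (g x ≟ b)
... | true  = cong suc (count-map g b xs)
... | false = count-map g b xs

count-++ : ∀ b xs ys → count b (xs ++ ys) ≡ count b xs + count b ys
count-++ b xs ys =
  trans (cong length (filter-++ (_≟ b) xs ys)) (length-++ (filter (_≟ b) xs))

count-total : ∀ xs → count 0F xs + count 1F xs ≡ length xs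
count-total []        = refl
count-total (0F ∷ xs) = cong suc (count-total xs)
count-total (1F ∷ xs) = trans (+-suc _ _) (cong suc (count-total xs))

count₁≡sum : ∀ xs → count 1F xs ≡ sum (map toℕ xs)
count₁≡sum []        = refl
count₁≡sum (0F ∷ xs) = count₁≡sum xs
count₁≡sum (1F ∷ xs) = cong suc (count₁≡sum xs)

#vertices≡count : ∀ {n} (f : Labeling n) b → #vertices f b ≡ count b (tabulate f)
#vertices≡count f b = trans (count-map f b (allFin _)) (cong (count b) (map-tabulate id f))

#edges≡count : ∀ {n} (G : Graph n) f b →
  #edges G f b ≡ count b (map (edgeLabel f) (edges G))
#edges≡count G f b = count-map (edgeLabel f) b (edges G)

#vertices-total : ∀ {n} (f : Labeling n) → #vertices f 0F + #vertices f 1F ≡ n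
#vertices-total f = begin
  #vertices f 0F + #vertices f 1F
    ≡⟨ cong₂ _+_ (#vertices≡count f 0F) (#vertices≡count f 1F) ⟩
  count 0F (tabulate f) + count 1F (tabulate f) ≡⟨ count-total (tabulate f) ⟩
  length (tabulate f)                           ≡⟨ length-tabulate f ⟩
  _                                             ∎

#edges-total : ∀ {n} (G : Graph n) f → #edges G f 0F + #edges G f 1F ≡ length (edges G)
#edges-total G f = begin
  #edges G f 0F + #edges G f 1F
    ≡⟨ cong₂ _+_ (#edges≡count G f 0F) (#edges≡count G f 1F) ⟩
  count 0F labels + count 1F labels ≡⟨ count-total labels ⟩
  length labels                     ≡⟨ length-map (edgeLabel f) (edges G) ⟩
  length (edges G)                  ∎
  where labels = map (edgeLabel f) (edges G)

#edges-addEdges : ∀ {n} (G : Graph n) es f b →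
  #edges (addEdges G es) f b ≡ #edges G f b + #edges (graph es) f b
#edges-addEdges G es f b = trans
  (cong length (filter-++ (λ e → edgeLabel f e ≟ b) (edges G) es))
  (length-++ (filter (λ e → edgeLabel f e ≟ b) (edges G)))

-- Rough equality.

RoughlyEqual-refl : ∀ x → RoughlyEqual x x
RoughlyEqual-refl x rewrite ∣n-n∣≡0 x = z≤n

RoughlyEqual-suc : ∀ x → RoughlyEqual x (suc x)
RoughlyEqual-suc zero    = s≤s z≤n
RoughlyEqual-suc (suc x) = RoughlyEqual-suc x

RoughlyEqual-sucˡ : ∀ x → RoughlyEqual (suc x) x
RoughlyEqual-sucˡ zero    = s≤s z≤n
RoughlyEqual-sucˡ (suc x) = RoughlyEqual-sucˡ x

-- Numbers with an even sum have an even difference, so a difference of at most 1 is 0.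
RoughlyEqual∧even⇒≡ : ∀ x y k → RoughlyEqual x y → x + y ≡ 2 * k → y ≡ k
RoughlyEqual∧even⇒≡ zero    zero    zero    _ _  = refl
RoughlyEqual∧even⇒≡ zero    1       k       _ eq = contradiction (sym eq) (even≢odd k 0)
RoughlyEqual∧even⇒≡ 1       zero    k       _ eq = contradiction (sym eq) (even≢odd k 0)
RoughlyEqual∧even⇒≡ zero    (suc (suc y)) k (s≤s ()) _
RoughlyEqual∧even⇒≡ (suc (suc x)) zero    k (s≤s ()) _
RoughlyEqual∧even⇒≡ (suc x) (suc y) (suc k) r eq =
  cong suc (RoughlyEqual∧even⇒≡ x y k r
    (suc-injective (trans (sym (+-suc x y)) (trans (suc-injective eq) (+-suc k _)))))

-- Augmented graphs and deficiency one.

tabulate-++ : ∀ {A : Set} m {n} (f : Fin m → A) (g : Fin n → A) →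
  tabulate (f Vector.++ g) ≡ tabulate f ++ tabulate g
tabulate-++ zero    f g = refl
tabulate-++ (suc m) f g = cong (f zero ∷_)
  -- On `suc i`, `splitAt (suc m)` is `splitAt m i` with `suc` mapped over the left summand;
  -- `[,]-map` absorbs that map into `f`.
  (trans (tabulate-cong (λ i → [,]-map (splitAt m i))) (tabulate-++ m (f ∘ suc) g))

#vertices-++ : ∀ {m n} (f : Labeling m) (g : Labeling n) b →
  #vertices (f Vector.++ g) b ≡ #vertices f b + #vertices g b
#vertices-++ {m} f g b = begin
  #vertices (f Vector.++ g) b                ≡⟨ #vertices≡count (f Vector.++ g) b ⟩
  count b (tabulate (f Vector.++ g))         ≡⟨ cong (count b) (tabulate-++ m f g) ⟩
  count b (tabulate f ++ tabulate g)         ≡⟨ count-++ b (tabulate f) (tabulate g) ⟩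
  count b (tabulate f) + count b (tabulate g)
    ≡⟨ cong₂ _+_ (#vertices≡count f b) (#vertices≡count g b) ⟨
  #vertices f b + #vertices g b              ∎

-- All edges have both ends in the left block, where the concatenated labeling agrees with `f`.
#edges-addIsolated : ∀ {n} (G : Graph n) k (f : Labeling n) (g : Labeling k) b →
  #edges (addIsolated G k) (f Vector.++ g) b ≡ #edges G f b
#edges-addIsolated G k f g b = begin
  #edges (addIsolated G k) (f Vector.++ g) b
    ≡⟨ #edges≡count (addIsolated G k) (f Vector.++ g) b ⟩
  count b (map (edgeLabel (f Vector.++ g)) (edges (addIsolated G k)))
    ≡⟨ cong (count b) (map-∘ (edges G)) ⟨
  count b (map _ (edges G))
    ≡⟨ cong (count b) (map-cong (λ e →
         cong₂ (λ x y → (toℕ x + toℕ y) mod 2)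
           (lookup-++ˡ f g (end₁ e)) (lookup-++ˡ f g (end₂ e))) (edges G)) ⟩
  count b (map (edgeLabel f) (edges G))
    ≡⟨ #edges≡count G f b ⟨
  #edges G f b ∎

-- One bound serves both nested minima: as no labeling of `G` is cordial, each needs at least one
-- edge, and `f` with `e` attains this.
IsCed-1 : ∀ {n} {G : Graph n} → (∀ f → ¬ Cordial G f) →
  ∀ f e → Cordial (addEdges G (e ∷ [])) f → IsCed G 1
IsCed-1 {n} {G} ¬cordial f e c@(friendly , _) =
    (f , friendly , ((e ∷ [] , refl , c) , needed f))
  , λ { j (f′ , _ , needs , _) → needed f′ j needs }
  where
  needed : ∀ f j → (∃[ es ] length {A = Edge n} es ≡ j × Cordial (addEdges G es) f) → 1 ≤ j
  needed f _ ([]    , refl , c) =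
    -- Adding no edge gives the edge list `edges G ++ []`, equal to `edges G` only propositionally.
    contradiction (subst (λ es → Cordial (graph es) f) (++-identityʳ (edges G)) c) (¬cordial f)
  needed f _ (_ ∷ _ , refl , _) = s≤s z≤n

IsCvd-1 : ∀ {n} {G : Graph n} → (∀ f → ¬ Cordial G f) →
  ∀ f g → EdgeBalanced G f → Friendly (Vector._++_ {n = 1} f g) → IsCvd G [ 1 ]
IsCvd-1 {n} {G} ¬cordial f g balanced friendly =
    (f , balanced , ((g , friendly , balanced⁺) , needed f))
  , λ { j (f′ , _ , needs , _) → needed f′ j needs }
  where
  balanced⁺ : EdgeBalanced (addIsolated G 1) (f Vector.++ g)
  balanced⁺ = subst₂ RoughlyEqual
    (sym (#edges-addIsolated G 1 f g 0F)) (sym (#edges-addIsolated G 1 f g 1F)) balanced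

  needed : ∀ f j → (∃[ g ] Cordial (addIsolated G j) (Vector._++_ {n = j} f g)) → 1 ≤ j
  needed f (suc j) _ = s≤s z≤n
  -- With no vertex added the labeling still lives on `n + 0` vertices, so cordiality is carried
  -- back to `f` through the counts.
  needed f zero (g , friendly , balanced) = contradiction
    ( subst₂ RoughlyEqual (unchanged 0F) (unchanged 1F) friendly
    , subst₂ RoughlyEqual (#edges-addIsolated G 0 f g 0F) (#edges-addIsolated G 0 f g 1F)
        balanced)
    (¬cordial f)
    where
    unchanged : ∀ b → #vertices (f Vector.++ g) b ≡ #vertices f b
    unchanged b = trans (#vertices-++ f g b) (+-identityʳ _)

-- The edge list of the wheel.

map-cone : ∀ {A B : Set} (F : B → B → A) {n} (G : Graph n) (f : Fin (suc n) → B) →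
  map (λ e → F (f (end₁ e)) (f (end₂ e))) (edges (cone G)) ≡
  tabulate (λ i → F (f zero) (f (suc i))) ++
    map (λ e → F (f (suc (end₁ e))) (f (suc (end₂ e)))) (edges G)
map-cone {A} F {n} G f = trans (map-++ h (tabulate spoke) _)
  (cong₂ _++_ (map-tabulate spoke h) (sym (map-∘ (edges G))))
  where
  h : Edge (suc n) → A
  h e = F (f (end₁ e)) (f (end₂ e))
  spoke : Fin n → Edge (suc n)
  spoke i = edge zero (suc i) (λ ())

map-cycle : ∀ {A B : Set} (F : B → B → A) {m} (3≤n : 3 ≤ 2 + m) (f : Fin (2 + m) → B) →
  map (λ e → F (f (end₁ e)) (f (end₂ e))) (edges (cycle (2 + m) 3≤n)) ≡
  F (f (fromℕ (suc m))) (f zero) ∷ tabulate (λ i → F (f (inject₁ i)) (f (suc i)))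
map-cycle {A} F {m} (s≤s (s≤s _)) f =
  cong (F (f (fromℕ (suc m))) (f zero) ∷_) (map-tabulate step h)
  where
  h : Edge (2 + m) → A
  h e = F (f (end₁ e)) (f (end₂ e))
  step : Fin (suc m) → Edge (2 + m)
  -- The proof of `loopless` differs from the one in `cycle`; the field is irrelevant, so the edges
  -- agree definitionally.
  step i = edge (inject₁ i) (suc i) (<⇒≢ (≤̄⇒inject₁< ≤-refl))

-- General `F` lets one unfolding serve for the number of edges (constant `F`), the sums of end
-- labels and the edge labels.
map-wheel : ∀ {A B : Set} (F : B → B → A) {m} (3≤n : 3 ≤ 2 + m) (f : Fin (3 + m) → B) →
  map (λ e → F (f (end₁ e)) (f (end₂ e))) (edges (wheel (2 + m) 3≤n)) ≡
  tabulate (λ i → F (f zero) (f (suc i))) ++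
    F (f (suc (fromℕ (suc m)))) (f 1F) ∷
    tabulate (λ i → F (f (suc (inject₁ i))) (f (suc (suc i))))
map-wheel F {m} 3≤n f = trans (map-cone F (cycle (2 + m) 3≤n) f)
  (cong (tabulate (λ i → F (f zero) (f (suc i))) ++_) (map-cycle F 3≤n (f ∘ suc)))

length-wheel : ∀ {m} (3≤n : 3 ≤ 2 + m) → length (edges (wheel (2 + m) 3≤n)) ≡ 2 * (2 + m)
length-wheel {m} 3≤n = begin
  length es                                   ≡⟨ length-map (λ _ → tt) es ⟨
  length (map (λ _ → tt) es)                  ≡⟨ cong length (map-wheel (λ _ _ → tt) 3≤n id) ⟩
  length (ts ++ tt ∷ tabulate {n = 1 + m} (λ _ → tt))  ≡⟨ length-++ ts ⟩
  length ts + suc (length (tabulate {n = 1 + m} (λ _ → tt)))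
    ≡⟨ cong₂ (λ x y → x + suc y) (length-tabulate {n = 2 + m} (λ _ → tt))
         (length-tabulate {n = 1 + m} (λ _ → tt)) ⟩
  2 + m + (2 + m)                             ≡⟨ lemma m ⟩
  2 * (2 + m)                                 ∎
  where
  es = edges (wheel (2 + m) 3≤n)
  ts = tabulate {n = 2 + m} (λ _ → tt)
  lemma : ∀ m → 2 + m + (2 + m) ≡ 2 * (2 + m)
  lemma = solve-∀

-- Sums of end labels and the parity obstruction.

sum-tabulate-const+ : ∀ n c (g : Fin n → ℕ) →
  sum (tabulate (λ i → c + g i)) ≡ n * c + sum (tabulate g)
sum-tabulate-const+ zero    c g = refl
sum-tabulate-const+ (suc n) c g =
  trans (cong (c + g zero +_) (sum-tabulate-const+ n c (g ∘ suc))) (lemma c (g zero) (n * c) _)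
  where
  lemma : ∀ c x y z → c + x + (y + z) ≡ c + y + (x + z)
  lemma = solve-∀

-- Around a cycle each entry occurs in two consecutive sums.
sum-tabulate-consecutive : ∀ n (g : Fin (suc n) → ℕ) →
  g (fromℕ n) + g zero + sum (tabulate (λ i → g (inject₁ i) + g (suc i))) ≡
  2 * sum (tabulate g)
sum-tabulate-consecutive zero    g = lemma (g zero)
  where
  lemma : ∀ x → x + x + 0 ≡ 2 * (x + 0)
  lemma = solve-∀
sum-tabulate-consecutive (suc n) g = begin
  -- Deleting the first vertex trades its edges `l + x` and `x + y` for a closing edge `l + y`, at
  -- the cost of `2 * x`.
  l + x + (x + y + s)           ≡⟨ lemma l x y s ⟩
  2 * x + (l + y + s)           ≡⟨ cong (2 * x +_) (sum-tabulate-consecutive n (g ∘ suc)) ⟩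
  2 * x + 2 * t                 ≡⟨ lemma′ x t ⟩
  2 * (x + t)                   ∎
  where
  l = g (fromℕ (suc n))
  x = g zero
  y = g 1F
  s = sum (tabulate (λ i → g (suc (inject₁ i)) + g (suc (suc i))))
  t = sum (tabulate (g ∘ suc))
  lemma : ∀ l x y s → l + x + (x + y + s) ≡ 2 * x + (l + y + s)
  lemma = solve-∀
  lemma′ : ∀ x t → 2 * x + 2 * t ≡ 2 * (x + t)
  lemma′ = solve-∀

endSum : ∀ {n} → Labeling n → Edge n → ℕ
endSum f e = toℕ (f (end₁ e)) + toℕ (f (end₂ e))

-- Reduction modulo 2 changes the end sum only where both ends are labelled 1, and `k` counts those
-- edges.
count₁-labels-parity : ∀ {n} (f : Labeling n) es →
  ∃[ k ] sum (map (endSum f) es) ≡ count 1F (map (edgeLabel f) es) + 2 * k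
count₁-labels-parity f []       = 0 , refl
count₁-labels-parity f (e ∷ es)
  with f (end₁ e) | f (end₂ e) | count₁-labels-parity f es
... | 0F | 0F | k , eq = k , eq
... | 0F | 1F | k , eq = k , cong suc eq
... | 1F | 0F | k , eq = k , cong suc eq
... | 1F | 1F | k , eq = suc k , trans (cong (2 +_) eq) (lemma _ k)
  where
  lemma : ∀ x k → 2 + (x + 2 * k) ≡ x + 2 * suc k
  lemma = solve-∀

-- The centre has degree n and every rim vertex has degree 3.
sum-endSum-wheel : ∀ {m} (3≤n : 3 ≤ 2 + m) (f : Labeling (3 + m)) →
  sum (map (endSum f) (edges (wheel (2 + m) 3≤n))) ≡
  (2 + m) * toℕ (f zero) + 3 * count 1F (tabulate (f ∘ suc))
sum-endSum-wheel {m} 3≤n f = begin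
  sum (map (endSum f) (edges (wheel (2 + m) 3≤n)))
    ≡⟨ cong sum (map-wheel (λ x y → toℕ x + toℕ y) 3≤n f) ⟩
  sum (spokes ++ last ∷ path)
    ≡⟨ sum-++ spokes (last ∷ path) ⟩
  sum spokes + (last + sum path)
    ≡⟨ cong₂ _+_ (sum-tabulate-const+ (2 + m) c r) (sum-tabulate-consecutive (suc m) r) ⟩
  (2 + m) * c + sum (tabulate r) + 2 * sum (tabulate r)
    ≡⟨ lemma ((2 + m) * c) (sum (tabulate r)) ⟩
  (2 + m) * c + 3 * sum (tabulate r)
    ≡⟨ cong (λ s → (2 + m) * c + 3 * s)
         (trans (count₁≡sum (tabulate (f ∘ suc))) (cong sum (map-tabulate (f ∘ suc) toℕ))) ⟨
  (2 + m) * c + 3 * count 1F (tabulate (f ∘ suc)) ∎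
  where
  c = toℕ (f zero)
  r = toℕ ∘ f ∘ suc
  spokes = tabulate (λ i → c + r i)
  last   = r (fromℕ (suc m)) + r zero
  path   = tabulate (λ i → r (inject₁ i) + r (suc i))
  lemma : ∀ x y → x + y + 2 * y ≡ x + 3 * y
  lemma = solve-∀

count₁-∷ : ∀ b xs → count 1F (b ∷ xs) ≡ toℕ b + count 1F xs
count₁-∷ 0F xs = refl
count₁-∷ 1F xs = refl

wheel-not-cordial : ∀ q (3≤n : 3 ≤ 3 + q * 4) f → ¬ Cordial (wheel (3 + q * 4) 3≤n) f
wheel-not-cordial q 3≤n f (friendly , balanced)
  with k , eq ← count₁-labels-parity f (edges (wheel (3 + q * 4) 3≤n))
  -- Both arguments halve the degree-weighted sum `(3 + q * 4) * c + 3 * R`. Odd degrees split it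
  -- into an even part and `c + R`, which friendliness makes even; edge balance makes the same sum
  -- odd.
  = even≢odd ((1 + q * 2) * c + R + (1 + q)) (1 + q * 2 + k) (begin
  2 * ((1 + q * 2) * c + R + (1 + q))        ≡⟨ lemma₁ q c R ⟩
  2 * ((1 + q * 2) * c + R) + (2 + q * 2)    ≡⟨ cong (2 * ((1 + q * 2) * c + R) +_) ones ⟨
  2 * ((1 + q * 2) * c + R) + (c + R)        ≡⟨ lemma₂ q c R ⟩
  (3 + q * 4) * c + 3 * R                    ≡⟨ sum-endSum-wheel 3≤n f ⟨
  sum (map (endSum f) (edges W))             ≡⟨ eq ⟩
  count 1F (map (edgeLabel f) (edges W)) + 2 * k
    ≡⟨ cong (_+ 2 * k) (#edges≡count W f 1F) ⟨
  #edges W f 1F + 2 * k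
    ≡⟨ cong (_+ 2 * k) (RoughlyEqual∧even⇒≡ (#edges W f 0F) (#edges W f 1F) (3 + q * 4) balanced
         (trans (#edges-total W f) (length-wheel 3≤n))) ⟩
  3 + q * 4 + 2 * k                          ≡⟨ lemma₃ q k ⟩
  suc (2 * (1 + q * 2 + k))                  ∎)
  where
  W = wheel (3 + q * 4) 3≤n
  c = toℕ (f zero)
  R = count 1F (tabulate (f ∘ suc))

  lemma₀ : ∀ q → 4 + q * 4 ≡ 2 * (2 + q * 2)
  lemma₀ = solve-∀
  lemma₁ : ∀ q c R → 2 * ((1 + q * 2) * c + R + (1 + q)) ≡ 2 * ((1 + q * 2) * c + R) + (2 + q * 2)
  lemma₁ = solve-∀
  lemma₂ : ∀ q c R → 2 * ((1 + q * 2) * c + R) + (c + R) ≡ (3 + q * 4) * c + 3 * R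
  lemma₂ = solve-∀
  lemma₃ : ∀ q k → 3 + q * 4 + 2 * k ≡ suc (2 * (1 + q * 2 + k))
  lemma₃ = solve-∀

  ones : c + R ≡ 2 + q * 2
  ones = begin
    c + R                  ≡⟨ count₁-∷ (f zero) (tabulate (f ∘ suc)) ⟨
    count 1F (tabulate f)  ≡⟨ #vertices≡count f 1F ⟨
    #vertices f 1F
      ≡⟨ RoughlyEqual∧even⇒≡ (#vertices f 0F) (#vertices f 1F) (2 + q * 2) friendly
           (trans (#vertices-total f) (lemma₀ q)) ⟩
    2 + q * 2              ∎

-- An explicit labeling of the wheel.

rimLabel : ℕ → Fin 2
rimLabel 0 = 0F
rimLabel 1 = 0F
rimLabel 2 = 1F
rimLabel 3 = 1F
rimLabel (suc (suc (suc (suc k)))) = rimLabel k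

wheelLabeling : Fin 2 → ∀ {n} → Labeling (suc n)
wheelLabeling c zero    = c
wheelLabeling c (suc i) = rimLabel (toℕ i)

_⊕_ : Fin 2 → Fin 2 → Fin 2
x ⊕ y = (toℕ x + toℕ y) mod 2

-- The number of labels b among 0, 0, 1, the remainder of the rim after its q
-- blocks 0, 0, 1, 1.
remainder : Fin 2 → ℕ
remainder 0F = 2
remainder 1F = 1

-- `c ⊕ x` is `b` exactly when `x` is `c ⊕ b`. Each block 0, 0, 1, 1 adds two of either label, and
-- the definitional period 4 of `rimLabel` restores the list after a block. Splitting on `c` and `b`
-- makes `remainder (c ⊕ b)` a numeral, so the `2` moves past it by computation.
count-rim : ∀ c b q →
  count b (tabulate {n = 3 + q * 4} (λ i → c ⊕ rimLabel (toℕ i))) ≡ remainder (c ⊕ b) + q * 2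
count-rim 0F 0F zero    = refl
count-rim 0F 1F zero    = refl
count-rim 1F 0F zero    = refl
count-rim 1F 1F zero    = refl
count-rim 0F 0F (suc q) = cong (2 +_) (count-rim 0F 0F q)
count-rim 0F 1F (suc q) = cong (2 +_) (count-rim 0F 1F q)
count-rim 1F 0F (suc q) = cong (2 +_) (count-rim 1F 0F q)
count-rim 1F 1F (suc q) = cong (2 +_) (count-rim 1F 1F q)

-- Along the rim the edge labels alternate 0, 1, 0, 1, and there are evenly many edges before the
-- closing one.
count-path : ∀ b q →
  count b (tabulate {n = 2 + q * 4} (λ i → rimLabel (toℕ (inject₁ i)) ⊕ rimLabel (suc (toℕ i)))) ≡
  1 + q * 2
count-path 0F zero    = refl
count-path 1F zero    = refl
count-path 0F (suc q) = cong (2 +_) (count-path 0F q)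
count-path 1F (suc q) = cong (2 +_) (count-path 1F q)

-- Makes the closing edge of the rim a 1-edge, since the first rim vertex is labelled 0.
rimLabel-last : ∀ q → rimLabel (toℕ (fromℕ (2 + q * 4))) ≡ 1F
rimLabel-last zero    = refl
rimLabel-last (suc q) = rimLabel-last q

-- The summands come from the spokes, the closing edge (`toℕ b`) and the rest of the rim.
#edges-wheelLabeling : ∀ c b q (3≤n : 3 ≤ 3 + q * 4) →
  #edges (wheel (3 + q * 4) 3≤n) (wheelLabeling c) b ≡
  remainder (c ⊕ b) + q * 2 + (toℕ b + (1 + q * 2))
#edges-wheelLabeling c b q 3≤n = begin
  #edges W (wheelLabeling c) b
    ≡⟨ #edges≡count W (wheelLabeling c) b ⟩
  count b (map (edgeLabel (wheelLabeling c)) (edges W))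
    ≡⟨ cong (count b) (map-wheel _⊕_ 3≤n (wheelLabeling c)) ⟩
  count b (spokes ++ (rimLabel (toℕ (fromℕ (2 + q * 4))) ⊕ 0F) ∷ path)
    ≡⟨ cong (λ x → count b (spokes ++ (x ⊕ 0F) ∷ path)) (rimLabel-last q) ⟩
  count b (spokes ++ 1F ∷ path)
    ≡⟨ count-++ b spokes (1F ∷ path) ⟩
  count b spokes + count b (1F ∷ path)
    ≡⟨ cong₂ _+_ (count-rim c b q)
         (trans (count-1∷ b path) (cong (toℕ b +_) (count-path b q))) ⟩
  remainder (c ⊕ b) + q * 2 + (toℕ b + (1 + q * 2)) ∎
  where
  W = wheel (3 + q * 4) 3≤n
  spokes = tabulate {n = 3 + q * 4} (λ i → c ⊕ rimLabel (toℕ i))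
  path = tabulate {n = 2 + q * 4} (λ i → rimLabel (toℕ (inject₁ i)) ⊕ rimLabel (suc (toℕ i)))
  count-1∷ : ∀ b xs → count b (1F ∷ xs) ≡ toℕ b + count b xs
  count-1∷ 0F xs = refl
  count-1∷ 1F xs = refl

#vertices-wheelLabeling : ∀ c b q →
  #vertices (wheelLabeling c {3 + q * 4}) b ≡ count b (c ∷ []) + (remainder b + q * 2)
#vertices-wheelLabeling c b q = begin
  #vertices (wheelLabeling c {3 + q * 4}) b
    ≡⟨ #vertices≡count (wheelLabeling c {3 + q * 4}) b ⟩
  count b ((c ∷ []) ++ rim)                 ≡⟨ count-++ b (c ∷ []) rim ⟩
  count b (c ∷ []) + count b rim            ≡⟨ cong (count b (c ∷ []) +_) (lemma b) ⟩
  count b (c ∷ []) + (remainder b + q * 2)  ∎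
  where
  rim = tabulate {n = 3 + q * 4} (rimLabel ∘ toℕ)
  0⊕ : ∀ x → 0F ⊕ x ≡ x
  0⊕ 0F = refl
  0⊕ 1F = refl
  lemma : ∀ b → count b rim ≡ remainder b + q * 2
  lemma b = begin
    count b rim
      -- The rim labels are read as the spoke labels of a centre labelled 0, so that `count-rim`
      -- applies.
      ≡⟨ cong (count b) (tabulate-cong {n = 3 + q * 4} (λ i → 0⊕ (rimLabel (toℕ i)))) ⟨
    count b (tabulate {n = 3 + q * 4} (λ i → 0F ⊕ rimLabel (toℕ i)))
      ≡⟨ count-rim 0F b q ⟩
    remainder (0F ⊕ b) + q * 2
      ≡⟨ cong (λ x → remainder x + q * 2) (0⊕ b) ⟩
    remainder b + q * 2 ∎

-- The two deficiencies of the wheel.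

ced-wheel : ∀ q (3≤n : 3 ≤ 3 + q * 4) → IsCed (wheel (3 + q * 4) 3≤n) 1
ced-wheel q 3≤n = IsCed-1 {G = W} (wheel-not-cordial q 3≤n) f e
  ( subst₂ RoughlyEqual (sym (#vertices-wheelLabeling 1F 0F q))
      (sym (#vertices-wheelLabeling 1F 1F q)) (RoughlyEqual-refl (2 + q * 2))
  , subst₂ RoughlyEqual (sym (#edges⁺ 0F)) (sym (#edges⁺ 1F))
      (subst₂ RoughlyEqual (lemma₀ q) (lemma₁ q) (RoughlyEqual-suc (3 + q * 4))))
  where
  W = wheel (3 + q * 4) 3≤n
  f : Labeling (4 + q * 4)
  f = wheelLabeling 1F
  e : Edge (4 + q * 4)
  -- The first two rim vertices are both labelled 0, so this edge, parallel to a rim edge, is a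
  -- 0-edge.
  e = edge 1F (suc 1F) (λ ())
  #edges⁺ : ∀ b → #edges (addEdges W (e ∷ [])) f b ≡
    remainder (1F ⊕ b) + q * 2 + (toℕ b + (1 + q * 2)) + #edges (graph (e ∷ [])) f b
  #edges⁺ b = trans (#edges-addEdges W (e ∷ []) f b)
    (cong (_+ #edges (graph (e ∷ [])) f b) (#edges-wheelLabeling 1F b q 3≤n))
  lemma₀ : ∀ q → 3 + q * 4 ≡ 1 + q * 2 + (0 + (1 + q * 2)) + 1
  lemma₀ = solve-∀
  lemma₁ : ∀ q → 4 + q * 4 ≡ 2 + q * 2 + (1 + (1 + q * 2)) + 0
  lemma₁ = solve-∀

cvd-wheel : ∀ q (3≤n : 3 ≤ 3 + q * 4) → IsCvd (wheel (3 + q * 4) 3≤n) [ 1 ]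
cvd-wheel q 3≤n = IsCvd-1 {G = wheel (3 + q * 4) 3≤n} (wheel-not-cordial q 3≤n) f g
  -- The spokes have one 0-edge too many and the rim one 1-edge too many, so the counts are equal.
  (subst₂ RoughlyEqual (sym (#edges-wheelLabeling 0F 0F q 3≤n))
    (trans (lemma q) (sym (#edges-wheelLabeling 0F 1F q 3≤n)))
    (RoughlyEqual-refl (2 + q * 2 + (1 + q * 2))))
  (subst₂ RoughlyEqual (sym (#vertices⁺ 0F)) (sym (#vertices⁺ 1F))
    (subst₂ RoughlyEqual (lemma₀ q) (lemma₁ q) (RoughlyEqual-sucˡ (2 + q * 2))))
  where
  f : Labeling (4 + q * 4)
  f = wheelLabeling 0F
  g : Labeling 1
  g _ = 1F
  #vertices⁺ : ∀ b → #vertices (f Vector.++ g) b ≡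
    count b (0F ∷ []) + (remainder b + q * 2) + #vertices g b
  #vertices⁺ b = trans (#vertices-++ f g b) (cong (_+ #vertices g b) (#vertices-wheelLabeling 0F b q))
  lemma : ∀ q → 2 + q * 2 + (1 + q * 2) ≡ 1 + q * 2 + (1 + (1 + q * 2))
  lemma = solve-∀
  lemma₀ : ∀ q → 3 + q * 2 ≡ 1 + (2 + q * 2) + 0
  lemma₀ = solve-∀
  lemma₁ : ∀ q → 2 + q * 2 ≡ 0 + (1 + q * 2) + 1
  lemma₁ = solve-∀

theorem6 : (n : ℕ) .{{_ : NonZero n}} (n%4≡3 : n % 4 ≡ 3) →
    IsCed (wheel n (n%4≡3⇒3≤n n n%4≡3)) 1 × IsCvd (wheel n (n%4≡3⇒3≤n n n%4≡3)) [ 1 ]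
theorem6 n n%4≡3 = at (n / 4) n≡3+[n/4]*4 (n%4≡3⇒3≤n n n%4≡3)
  where
  n≡3+[n/4]*4 : n ≡ 3 + n / 4 * 4
  n≡3+[n/4]*4 = trans (m≡m%n+[m/n]*n n 4) (cong (_+ n / 4 * 4) n%4≡3)

  -- The bound is generalised together with `n`, so that matching `refl` can substitute inside the
  -- wheel.
  at : ∀ {n} q → n ≡ 3 + q * 4 → (3≤n : 3 ≤ n) → IsCed (wheel n 3≤n) 1 × IsCvd (wheel n 3≤n) [ 1 ]
  at q refl 3≤n = ced-wheel q 3≤n , cvd-wheel q 3≤n
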